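{- LCP-aware insertion sort, as described in the context, sorts any sequence of $n$ strings with common prefix length $\bar h$ and computes its LCP array $H$; it performs at most $L(H)+\frac{n(n-1)}{2}$ character comparisons and runs in $O(D+n^2)$ time.
   Context: Strings are zero-terminated finite sequences over a totally ordered alphabet, ordered lexicographically; $\mathrm{lcp}(s,t)$ is the length of their longest common prefix. For a sorted sequence $s_1\le\dots\le s_n$ its LCP array is $H=(\bot,h_2,\dots,h_n)$, $h_i=\mathrm{lcp}(s_{i-1},s_i)$, and $L(H)=\sum_{i\ge2}h_i$. $D$ is the distinguishing prefix size: the sum over the strings of the length of the shortest prefix not shared by any other string of the input ($D\ge L(H)$). LCP-aware insertion sort: for $j=1,\dots,n$ the string $x=s_j$ is inserted into the already sorted prefix $s_1,\dots,s_{j-1}$ (whose LCP array is maintained) by scanning positions from the right while shifting elements (and their LCP entries) one place to the right. The scan maintains $h'$, the known LCP of $x$ with the element $t$ immediately to its right in the final order so far (initially $h'=\bar h$, with no element to the right). At each step let $u$ be the next element to the left, with stored LCP $g=\mathrm{lcp}(u,t)$ ($t$ the element just passed). If there is no such $u$, insert $x$ at the front. If $g<h'$: $x>u$, so $x$ is inserted between $u$ and $t$, with LCP entries $\mathrm{lcp}(u,x)=g$ and $\mathrm{lcp}(x,t)=h'$. If $g>h'$: $x<u$ without character comparisons; $u$ is shifted right and the scan continues with $h'$ unchanged. If $g=h'$: characters of $x$ and $u$ are compared from position $h'+1$ on, increasing the common length $h''$ while they are equal and not the terminator; if then $x\ge u$, insert $x$ between $u$ and $t$ with LCP entries $h''$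 (to $u$) and the old $h'$ (to $t$); otherwise shift $u$ right and continue with $h':=h''$. Counting convention: each character comparison yielding equality counts one, and the final mismatch test together with the $\ge$ test counts one; no other comparisons are character comparisons. -}

module Defs where

open import Data.Bool.Base using (Bool; true; false)
open import Data.Fin.Base using (Fin)
open import Data.List.Base
  using (List; []; _∷_; _++_; [_]; length; map; drop; reverse; zipWith;
         catMaybes; inits; find; lookup; removeAt; tabulate)
open import Data.List.Relation.Binary.Lex.Strict using (≤-decTotalOrder)
open import Data.List.Relation.Binary.Prefix.Heterogeneous using (Prefix)
open import Data.List.Relation.Binary.Prefix.Heterogeneous.Properties using (prefix?)
open import Data.List.Relation.Unary.All using (All)
open import Data.List.Relation.Unary.Any using (Any; any?)
import Data.List.Relation.Unary.Sorted.TotalOrder as SortedList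
open import Data.Maybe.Base using (Maybe; just; nothing; maybe′)
open import Data.Nat.Base using (ℕ; zero; suc; _+_)
open import Data.Nat.ListAction using (sum)
open import Data.Nat.Properties using (<-cmp)
open import Data.Product.Base using (_×_; _,_; proj₁; proj₂; map₂; ∃-syntax)
open import Level using (_⊔_)
open import Relation.Binary.Bundles using (StrictTotalOrder; DecTotalOrder)
open import Relation.Binary.Definitions using (tri<; tri≈; tri>)
import Relation.Binary.Construct.Add.Infimum.Equality as AddInfimum
open import Relation.Binary.PropositionalEquality.Core using (_≡_)
open import Relation.Nullary.Construct.Add.Infimum using (_₋; ⊥₋) renaming ([_] to char)
open import Relation.Nullary.Decidable.Core using (yes; no)
open import Relation.Nullary.Decidable using (¬?)
open import Relation.Unary using (Decidable)

-- Constant-time operations of a random-access machine running the algorithm.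
data Op : Set where
  nextString : Op  -- loop test (and advance) of the outer loop over j
  boundTest  : Op  -- is there a further element u to the left?
  lcpTest    : Op  -- three-way comparison of the integers g and h′
  charEqual  : Op  -- character comparison yielding equality (not of terminators)
  charFinal  : Op  -- final mismatch test together with the ≥ test
  shift      : Op  -- move an element and its LCP entry one place to the right
  place      : Op  -- write x and the LCP entries on both sides of it

Trace : Set
Trace = List Op

cost : (Op → ℕ) → Trace → ℕ
cost w ops = sum (map w ops)

charWeight : Op → ℕ
charWeight charEqual = 1
charWeight charFinal = 1
charWeight _         = 0

charComparisons : Trace → ℕ
charComparisons = cost charWeight

-- An LCP array (⊥, h₂, …, hₙ), with ⊥ represented by `nothing`.
LCPArray : Set
LCPArray = List (Maybe ℕ)

L : LCPArray → ℕ
L H = sum (catMaybes H)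

module Strings {a ℓ₁ ℓ₂} (Alphabet : StrictTotalOrder a ℓ₁ ℓ₂) where

  open StrictTotalOrder Alphabet using (_≈_; _≟_; compare) renaming (Carrier to Char)

  -- The terminator is the end of the list.  It is smaller than every
  -- character, which is how the library's lexicographic order treats it.
  String : Set a
  String = List Char

  -- The string with its terminator ⊥₋ written out.
  terminated : String → List (Char ₋)
  terminated s = map char s ++ [ ⊥₋ ]

  open SortedList (DecTotalOrder.totalOrder (≤-decTotalOrder Alphabet)) public
    using (Sorted)

  -- The terminator does not count towards the LCP of two equal strings.
  lcp : String → String → ℕ
  lcp []      _       = 0
  lcp (_ ∷ _) []      = 0
  lcp (c ∷ s) (d ∷ t) with c ≟ d
  ... | yes _ = suc (lcp s t)
  ... | no  _ = 0

  lcpArray : List String → LCPArray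
  lcpArray []       = []
  lcpArray (s ∷ ss) = nothing ∷ map just (zipWith lcp (s ∷ ss) ss)

  -- h̄ need not be the maximal length of a common prefix.
  HasCommonPrefixLength : ℕ → List String → Set (a ⊔ ℓ₁)
  HasCommonPrefixLength h̄ ss = ∃[ p ] length p ≡ h̄ × All (Prefix _≈_ p) ss

  open AddInfimum _≈_ using (_≈₋_; ≈₋-dec)

  SharedBy : List String → List (Char ₋) → Set (a ⊔ ℓ₁)
  SharedBy others p = Any (λ t → Prefix _≈₋_ p (terminated t)) others

  sharedBy? : ∀ others → Decidable (SharedBy others)
  sharedBy? others p = any? (λ t → prefix? (≈₋-dec _≟_) p (terminated t)) others

  -- `inits` lists the prefixes by increasing length.  A string that occurs
  -- more than once has no unshared prefix; it contributes its whole length,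
  -- terminator included.
  distinguishingLength : String → List String → ℕ
  distinguishingLength s others =
    length (maybe′ (λ p → p) (terminated s)
             (find (λ p → ¬? (sharedBy? others p)) (inits (terminated s))))

  D : List String → ℕ
  D ss = sum (tabulate λ (i : Fin (length ss)) →
                distinguishingLength (lookup ss i) (removeAt ss i))

  -- The sorted prefix of the array, listed from right to left since it is
  -- scanned from the right.  The element u is paired with g = lcp(u , t), t
  -- being its right neighbour.  The rightmost element has no right neighbour;
  -- its g is the sentinel h̄, so that the first step of a scan, where h′ = h̄,
  -- compares characters.
  Slots : Set a
  Slots = List (ℕ × String)

  -- Character comparison of the suffixes of x and u starting at the current
  -- position: how many further characters agree, whether x ≥ u, and the
  -- operations performed.  When a terminator is reached only the final test
  -- is made.
  extend : String → String → ℕ × Bool × Trace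
  extend []      []      = 0 , true  , charFinal ∷ []
  extend []      (_ ∷ _) = 0 , false , charFinal ∷ []
  extend (_ ∷ _) []      = 0 , true  , charFinal ∷ []
  extend (c ∷ x) (d ∷ u) with compare c d
  ... | tri< _ _ _ = 0 , false , charFinal ∷ []
  ... | tri> _ _ _ = 0 , true  , charFinal ∷ []
  ... | tri≈ _ _ _ with extend x u
  ...   | k , x≥u , ops = suc k , x≥u , charEqual ∷ ops

  -- `drop h′` is indexing at position h′ + 1, hence not charged.
  scan : String → ℕ → Slots → Slots × Trace
  scan x h′ [] = (h′ , x) ∷ [] , boundTest ∷ place ∷ []
  scan x h′ ((g , u) ∷ us) with <-cmp g h′
  ... | tri< _ _ _ = (h′ , x) ∷ (g , u) ∷ us , boundTest ∷ lcpTest ∷ place ∷ []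
  ... | tri> _ _ _ with scan x h′ us
  ...   | us′ , ops = (g , u) ∷ us′ , boundTest ∷ lcpTest ∷ shift ∷ ops
  scan x h′ ((g , u) ∷ us) | tri≈ _ _ _ with extend (drop h′ x) (drop h′ u)
  ...   | k , true  , cs =
            (h′ , x) ∷ (h′ + k , u) ∷ us , boundTest ∷ lcpTest ∷ cs ++ place ∷ []
  ...   | k , false , cs with scan x (h′ + k) us
  ...     | us′ , ops = (g , u) ∷ us′ , boundTest ∷ lcpTest ∷ cs ++ shift ∷ ops

  insertAll : ℕ → Slots → List String → Slots × Trace
  insertAll h̄ slots []       = slots , nextString ∷ []
  insertAll h̄ slots (x ∷ xs) with scan x h̄ slots
  ... | slots′ , ops = map₂ (λ ops′ → nextString ∷ ops ++ ops′) (insertAll h̄ slots′ xs)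

  -- Reading the array from left to right; the sentinel is not part of it.
  slotStrings : Slots → List String
  slotStrings slots = reverse (map proj₂ slots)

  slotLCPs : Slots → LCPArray
  slotLCPs []          = []
  slotLCPs (_ ∷ slots) = nothing ∷ reverse (map (λ slot → just (proj₁ slot)) slots)

  record Run : Set a where
    field
      strings : List String
      lcps    : LCPArray
      trace   : Trace

  lcpInsertionSort : ℕ → List String → Run
  lcpInsertionSort h̄ ss with insertAll h̄ [] ss
  ... | slots , ops = record
    { strings = slotStrings slots ; lcps = slotLCPs slots ; trace = ops }

{-# OPTIONS --safe #-}
module Submission where

-- Of lcp u t, lcp x t and lcp u x the two smallest agree.  Hence inserting x between u and t
-- replaces g = lcp u t by g and max(lcp u x , lcp x t), and that maximum is at least h̄ plus the
-- number of equal comparisons made during the scan.  So all the equal comparisons together are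
-- paid for by L(H), and each step of a scan makes at most one final comparison.  For the running
-- time, the LCP of a string with its right neighbour in sorted order is a shared prefix of it,
-- so L(H) ≤ D.

open import Defs
open import Data.Bool.Base using (true; false; if_then_else_)
open import Data.Fin.Base using (Fin)
open import Data.List.Base
  using (List; []; _∷_; _++_; length; map; drop; reverseAcc; zipWith; inits; find;
         lookup; removeAt; tabulate)
open import Data.List.Membership.Propositional using (_∈_; lose)
open import Data.List.Properties using (map-++; map-∘; tabulate-cong; length-map; ++-identityʳ)
open import Data.List.Relation.Binary.Lex.Strict using (≤-decTotalOrder; base; halt; this; next)
open import Data.List.Relation.Binary.Permutation.Propositional as ↭
  using (_↭_; ↭-refl; ↭-sym; ↭-trans; ↭-reflexive)
open import Data.List.Relation.Binary.Permutation.Propositional.Properties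
  using (Any-resp-↭; ++⁺ˡ; ↭-reverse; ↭-length) renaming (shift to ↭-shift)
open import Data.List.Relation.Binary.Prefix.Heterogeneous using (Prefix; []; _∷_)
open import Data.List.Relation.Unary.All as All using (All; []; _∷_)
open import Data.List.Relation.Unary.All.Properties using (gmap⁺)
open import Data.List.Relation.Unary.Any using (here; there)
open import Data.List.Relation.Unary.Linked using ([]; [-]; _∷_)
open import Data.Maybe.Base using (just; nothing; maybe′)
open import Data.Nat.Base using (ℕ; zero; suc; _+_; _*_; _∸_; _^_; _≤_; _<_; z≤n; s≤s)
open import Data.Nat.DivMod using (_/_; m*n/n≡m)
open import Data.Nat.ListAction using (sum)
open import Data.Nat.ListAction.Properties using (sum-++)
open import Data.Nat.Properties
  using (<-cmp; <-irrefl; <⇒≤; ≰⇒>; ≤-refl; ≤-reflexive; ≤-trans; +-comm; +-identityʳ; *-comm; *-identityʳ;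
         *-suc; *-zeroʳ; +-cancelʳ-≡; +-cancelˡ-≤; +-mono-≤; +-monoˡ-≤; +-monoʳ-≤; *-monoʳ-≤;
         m≤m+n; m≤n+m; m≤m*n; module ≤-Reasoning)
open import Data.Nat.Tactic.RingSolver using (solve-∀)
open import Data.Product.Base using (_×_; _,_; proj₁; proj₂; ∃-syntax)
open import Function.Base using (_∘_; id)
open import Level using (_⊔_)
open import Relation.Binary.Bundles using (StrictTotalOrder; DecTotalOrder)
open import Relation.Binary.Definitions using (tri<; tri≈; tri>)
import Relation.Binary.Construct.Add.Infimum.Equality as AddInfimum
open import Relation.Binary.PropositionalEquality
  using (_≡_; refl; sym; trans; cong; cong₂; module ≡-Reasoning)
open import Relation.Nullary.Decidable.Core using (yes; no)
open import Relation.Nullary.Decidable using (¬?)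
open import Relation.Nullary.Negation.Core using (contradiction)
open import Relation.Unary using (Decidable)

-- Arithmetic and list preliminaries.

≤-slack : ∀ {m n} k → m + k ≡ n → m ≤ n
≤-slack {m} k refl = m≤m+n m k

-- The sorted prefix has the lengths `m`, `m + 1`, ... when `k` further strings are inserted one by
-- one; each length bounds the number of elements that one scan inspects.
rangeSum : ℕ → ℕ → ℕ
rangeSum m zero    = 0
rangeSum m (suc k) = m + rangeSum (suc m) k

-- The arithmetic series, cleared of division and subtraction so that the semiring solver applies.
rangeSum-closed : ∀ m k → rangeSum m k * 2 + k ≡ k * (2 * m + k)
rangeSum-closed m zero    = refl
rangeSum-closed m (suc k) = begin
  (m + rangeSum (suc m) k) * 2 + suc k      ≡⟨ regroup m (rangeSum (suc m) k) k ⟩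
  rangeSum (suc m) k * 2 + k + (2 * m + 1)  ≡⟨ cong (_+ (2 * m + 1)) (rangeSum-closed (suc m) k) ⟩
  k * (2 * suc m + k) + (2 * m + 1)         ≡⟨ expand m k ⟩
  suc k * (2 * m + suc k)                   ∎
  where
  open ≡-Reasoning
  regroup : ∀ m r k → (m + r) * 2 + suc k ≡ r * 2 + k + (2 * m + 1)
  regroup = solve-∀
  expand : ∀ m k → k * (2 * suc m + k) + (2 * m + 1) ≡ suc k * (2 * m + suc k)
  expand = solve-∀

rangeSum-0 : ∀ n → rangeSum 0 n ≡ n * (n ∸ 1) / 2
rangeSum-0 n = begin
  rangeSum 0 n            ≡⟨ m*n/n≡m (rangeSum 0 n) 2 ⟨
  rangeSum 0 n * 2 / 2    ≡⟨ cong (_/ 2) (+-cancelʳ-≡ n _ _ (trans (rangeSum-closed 0 n) (square n))) ⟩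
  n * (n ∸ 1) / 2         ∎
  where
  open ≡-Reasoning
  square : ∀ n → n * n ≡ n * (n ∸ 1) + n
  square zero    = refl
  square (suc n) = trans (*-suc (suc n) n) (+-comm (suc n) (suc n * n))

rangeSum-≤-square : ∀ n → rangeSum 0 n ≤ n * n
rangeSum-≤-square n = begin
  rangeSum 0 n          ≤⟨ m≤m*n (rangeSum 0 n) 2 ⟩
  rangeSum 0 n * 2      ≤⟨ m≤m+n _ n ⟩
  rangeSum 0 n * 2 + n  ≡⟨ rangeSum-closed 0 n ⟩
  n * n                 ∎
  where open ≤-Reasoning

cost-++ : ∀ w xs ys → cost w (xs ++ ys) ≡ cost w xs + cost w ys
cost-++ w xs ys = trans (cong sum (map-++ w xs ys)) (sum-++ (map w xs) (map w ys))

L-reverseAcc : ∀ acc gs → L (reverseAcc acc (map just gs)) ≡ sum gs + L acc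
L-reverseAcc acc []       = refl
L-reverseAcc acc (g ∷ gs) = begin
  L (reverseAcc (just g ∷ acc) (map just gs))  ≡⟨ L-reverseAcc (just g ∷ acc) gs ⟩
  sum gs + (g + L acc)                         ≡⟨ shuffle (sum gs) g (L acc) ⟩
  g + sum gs + L acc                           ∎
  where
  open ≡-Reasoning
  shuffle : ∀ s g l → s + (g + l) ≡ g + s + l
  shuffle = solve-∀

find-cong : ∀ {a p q} {A : Set a} {P : A → Set p} {Q : A → Set q}
            (P? : Decidable P) (Q? : Decidable Q) →
            (∀ x → P x → Q x) → (∀ x → Q x → P x) →
            ∀ xs → find P? xs ≡ find Q? xs
find-cong P? Q? P⇒Q Q⇒P []       = refl
find-cong P? Q? P⇒Q Q⇒P (x ∷ xs) with P? x | Q? x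
... | yes p | yes q = refl
... | no ¬p | no ¬q = find-cong P? Q? P⇒Q Q⇒P xs
... | yes p | no ¬q = contradiction (P⇒Q x p) ¬q
... | no ¬p | yes q = contradiction (Q⇒P x q) ¬p

find-length-≥ : ∀ {a p} {A : Set a} {P : List A → Set p} (P? : Decidable P) m d {xss} →
                All (λ xs → P xs → m ≤ length xs) xss → m ≤ length d →
                m ≤ length (maybe′ id d (find P? xss))
find-length-≥ P? m d                    []              m≤d = m≤d
find-length-≥ P? m d {xss = xs ∷ _} (long ∷ longs) m≤d with P? xs
... | yes p = long p
... | no  _ = find-length-≥ P? m d longs m≤d

-- Sums over the entries of a list, each paired with the remaining entries.

module _ {a} {A : Set a} where

  -- `D` unfolds to this sum at `distinguishingLength`. A general `f` makes induction possible: a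
  -- head that is split off is put back inside the second argument of `f`.
  sumPicks : (A → List A → ℕ) → List A → ℕ
  sumPicks f xs = sum (tabulate λ (i : Fin (length xs)) → f (lookup xs i) (removeAt xs i))

  sumPicks-cong : ∀ {f g} → (∀ x ys → f x ys ≡ g x ys) → ∀ xs → sumPicks f xs ≡ sumPicks g xs
  sumPicks-cong f≗g xs = cong sum (tabulate-cong (λ i → f≗g (lookup xs i) (removeAt xs i)))

  sumPicks-↭ : ∀ f → (∀ x {ys zs} → ys ↭ zs → f x ys ≡ f x zs) →
               ∀ {xs ys} → xs ↭ ys → sumPicks f xs ≡ sumPicks f ys
  sumPicks-↭ f f-↭ ↭.refl         = refl
  sumPicks-↭ f f-↭ (↭.prep x p)   =
    cong₂ _+_ (f-↭ x p) (sumPicks-↭ (λ z zs → f z (x ∷ zs)) (λ z → f-↭ z ∘ ↭.prep x) p)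
  sumPicks-↭ f f-↭ (↭.trans p q)  = trans (sumPicks-↭ f f-↭ p) (sumPicks-↭ f f-↭ q)
  sumPicks-↭ f f-↭ (↭.swap {xs} {ys} x y p) = begin
    f x (y ∷ xs) + (f y (x ∷ xs) + sumPicks f′ xs)
      ≡⟨ cong₂ _+_ (f-↭ x (↭.prep y p)) (cong₂ _+_ (f-↭ y (↭.prep x p))
           (trans (sumPicks-↭ f′ (λ z → f-↭ z ∘ ↭.prep x ∘ ↭.prep y) p)
                  -- `f′` and `f″` differ only in the order of `x` and `y` among the remaining
                  -- entries.
                  (sumPicks-cong (λ z zs → f-↭ z {x ∷ y ∷ zs} (↭.swap x y ↭.refl)) ys))) ⟩
    f x (y ∷ ys) + (f y (x ∷ ys) + sumPicks f″ ys)
      ≡⟨ shuffle (f x (y ∷ ys)) (f y (x ∷ ys)) (sumPicks f″ ys) ⟩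
    f y (x ∷ ys) + (f x (y ∷ ys) + sumPicks f″ ys) ∎
    where
    open ≡-Reasoning
    f′ f″ : A → List A → ℕ
    f′ z zs = f z (x ∷ y ∷ zs)
    f″ z zs = f z (y ∷ x ∷ zs)
    shuffle : ∀ m n o → m + (n + o) ≡ n + (m + o)
    shuffle = solve-∀

-- What a step of a scan costs apart from its equal character comparisons.
stepCost insertionCost : (Op → ℕ) → ℕ
stepCost w      = w boundTest + w lcpTest + w charFinal + w shift
insertionCost w = w boundTest + w place

-- Each round of the outer loop is charged `insertionCost w + w nextString`; the second
-- `w nextString` is for the loop test that ends the run.
timeConstant : (Op → ℕ) → ℕ
timeConstant w = w charEqual + (stepCost w + (insertionCost w + w nextString + w nextString))

-- The induction steps of scan-cost, one for each branch of a scan.  S and S′ are the sums of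
-- the LCP entries left of u before and after, o is the cost of the rest of the scan.
module ScanBound (b l c s p e : ℕ) {A i} (step : b + l + c + s ≤ A) (insertion : b + p ≤ i) where

  front : ∀ h → b + (p + 0) + e * (h + 0) ≤ e * (h + 0) + (A * 0 + i)
  front h = begin
    b + (p + 0) + e * (h + 0)  ≡⟨ before b p (e * (h + 0)) ⟩
    e * (h + 0) + (b + p)      ≤⟨ +-monoʳ-≤ (e * (h + 0)) insertion ⟩
    e * (h + 0) + i            ≡⟨ after (e * (h + 0)) A i ⟩
    e * (h + 0) + (A * 0 + i)  ∎
    where
    open ≤-Reasoning
    before : ∀ b p x → b + (p + 0) + x ≡ x + (b + p)
    before = solve-∀
    after : ∀ x A i → x + i ≡ x + (A * 0 + i)
    after = solve-∀

  compared-insert : ∀ h k S n → b + (l + (e * k + c + (p + 0))) + e * (h + (h + S)) ≤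
                                e * (h + (h + k + S)) + (A * suc n + i)
  compared-insert h k S n = begin
    b + (l + (e * k + c + (p + 0))) + e * (h + (h + S))
      -- A full step and a full insertion together include a second bound test and a shift, which
      -- this branch does not perform: the slack is `b + s`.
      ≤⟨ ≤-slack _ (before b l c s p e h k S) ⟩
    e * (h + (h + k + S)) + ((b + l + c + s) + (b + p))
      ≤⟨ +-monoʳ-≤ (e * (h + (h + k + S))) (+-mono-≤ step insertion) ⟩
    e * (h + (h + k + S)) + (A + i)
      ≤⟨ ≤-slack _ (after (e * (h + (h + k + S))) A n i) ⟩
    e * (h + (h + k + S)) + (A * suc n + i) ∎
    where
    open ≤-Reasoning
    before : ∀ b l c s p e h k S → b + (l + (e * k + c + (p + 0))) + e * (h + (h + S)) + (b + s) ≡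
                                   e * (h + (h + k + S)) + ((b + l + c + s) + (b + p))
    before = solve-∀
    after : ∀ x A n i → x + (A + i) + A * n ≡ x + (A * suc n + i)
    after = solve-∀

  uncompared-insert : ∀ h g S n → b + (l + (p + 0)) + e * (h + (g + S)) ≤ e * (h + (g + S)) + (A * suc n + i)
  uncompared-insert h g S n = begin
    b + (l + (p + 0)) + e * (h + (g + S))
      ≤⟨ ≤-slack _ (before b l c s p (e * (h + (g + S)))) ⟩
    e * (h + (g + S)) + ((b + l + c + s) + (b + p))
      ≤⟨ +-monoʳ-≤ (e * (h + (g + S))) (+-mono-≤ step insertion) ⟩
    e * (h + (g + S)) + (A + i)
      ≤⟨ ≤-slack _ (after (e * (h + (g + S))) A n i) ⟩
    e * (h + (g + S)) + (A * suc n + i) ∎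
    where
    open ≤-Reasoning
    before : ∀ b l c s p x → b + (l + (p + 0)) + x + (b + c + s) ≡ x + ((b + l + c + s) + (b + p))
    before = solve-∀
    after : ∀ x A n i → x + (A + i) + A * n ≡ x + (A * suc n + i)
    after = solve-∀

  compared-shift : ∀ {o h k g S S′ n} → o + e * (h + k + S) ≤ e * S′ + (A * n + i) →
                   b + (l + (e * k + c + (s + o))) + e * (h + (g + S)) ≤ e * (g + S′) + (A * suc n + i)
  compared-shift {o} {h} {k} {g} {S} {S′} {n} rest = begin
    -- The `k` equal comparisons turn into the growth of `h` to `h + k`, the value with which the
    -- rest of the scan starts.
    b + (l + (e * k + c + (s + o))) + e * (h + (g + S))   ≡⟨ before b l c s o e h k g S ⟩
    (o + e * (h + k + S)) + (e * g + (b + l + c + s))     ≤⟨ +-mono-≤ rest (+-monoʳ-≤ (e * g) step) ⟩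
    (e * S′ + (A * n + i)) + (e * g + A)                  ≡⟨ after e S′ A n i g ⟩
    e * (g + S′) + (A * suc n + i)                        ∎
    where
    open ≤-Reasoning
    before : ∀ b l c s o e h k g S → b + (l + (e * k + c + (s + o))) + e * (h + (g + S)) ≡
                                     (o + e * (h + k + S)) + (e * g + (b + l + c + s))
    before = solve-∀
    after : ∀ e S′ A n i g → (e * S′ + (A * n + i)) + (e * g + A) ≡ e * (g + S′) + (A * suc n + i)
    after = solve-∀

  uncompared-shift : ∀ {o h g S S′ n} → o + e * (h + S) ≤ e * S′ + (A * n + i) →
                     b + (l + (s + o)) + e * (h + (g + S)) ≤ e * (g + S′) + (A * suc n + i)
  uncompared-shift {o} {h} {g} {S} {S′} {n} rest = begin
    b + (l + (s + o)) + e * (h + (g + S))              ≤⟨ ≤-slack c (before b l c s o e h g S) ⟩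
    (o + e * (h + S)) + (e * g + (b + l + c + s))      ≤⟨ +-mono-≤ rest (+-monoʳ-≤ (e * g) step) ⟩
    (e * S′ + (A * n + i)) + (e * g + A)               ≡⟨ after e S′ A n i g ⟩
    e * (g + S′) + (A * suc n + i)                     ∎
    where
    open ≤-Reasoning
    before : ∀ b l c s o e h g S → b + (l + (s + o)) + e * (h + (g + S)) + c ≡
                                   (o + e * (h + S)) + (e * g + (b + l + c + s))
    before = solve-∀
    after : ∀ e S′ A n i g → (e * S′ + (A * n + i)) + (e * g + A) ≡ e * (g + S′) + (A * suc n + i)
    after = solve-∀

module Correctness {a ℓ₁ ℓ₂} (Alphabet : StrictTotalOrder a ℓ₁ ℓ₂) where
  open Strings Alphabet
  open StrictTotalOrder Alphabet
    using (_≈_; _≟_; compare; irrefl; <-respʳ-≈; module Eq)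
  open AddInfimum _≈_ using (_≈₋_) renaming ([_] to [_]₋)
  open DecTotalOrder (≤-decTotalOrder Alphabet) using () renaming (_≤_ to _≼_)

  -- Running time in terms of the LCP entries

  lcpSum : Slots → ℕ
  lcpSum slots = sum (map proj₁ slots)

  extend-cost : ∀ w x u → cost w (proj₂ (proj₂ (extend x u))) ≡
                          w charEqual * proj₁ (extend x u) + w charFinal
  extend-cost w x u = go x u
    where
    final : w charFinal + 0 ≡ w charEqual * 0 + w charFinal
    final = trans (+-comm (w charFinal) 0) (cong (_+ w charFinal) (sym (*-zeroʳ (w charEqual))))
    more : ∀ e k c → e + (e * k + c) ≡ e * suc k + c
    more = solve-∀
    go : ∀ x u → cost w (proj₂ (proj₂ (extend x u))) ≡
                 w charEqual * proj₁ (extend x u) + w charFinal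
    go []      []      = final
    go []      (_ ∷ _) = final
    go (_ ∷ _) []      = final
    go (c ∷ x) (d ∷ u) with compare c d
    ... | tri< _ _ _ = final
    ... | tri> _ _ _ = final
    ... | tri≈ _ _ _ =
      trans (cong (w charEqual +_) (go x u)) (more (w charEqual) (proj₁ (extend x u)) (w charFinal))

  -- h′ is part of the left-hand side because inserting x between u and t raises
  -- the sum of the LCPs by max(lcp u x , lcp x t), the value h′ has grown to.
  scan-cost : ∀ w x h′ slots →
              cost w (proj₂ (scan x h′ slots)) + w charEqual * (h′ + lcpSum slots) ≤
              w charEqual * lcpSum (proj₁ (scan x h′ slots)) +
                (stepCost w * length slots + insertionCost w)
  scan-cost w x h′ slots = go h′ slots
    where
    open ScanBound (w boundTest) (w lcpTest) (w charFinal) (w shift) (w place) (w charEqual)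
                   {stepCost w} {insertionCost w} ≤-refl ≤-refl
    go : ∀ h′ slots →
         cost w (proj₂ (scan x h′ slots)) + w charEqual * (h′ + lcpSum slots) ≤
         w charEqual * lcpSum (proj₁ (scan x h′ slots)) + (stepCost w * length slots + insertionCost w)
    go h′ [] = front h′
    go h′ ((g , u) ∷ us) with <-cmp g h′
    ... | tri< _ _ _ = uncompared-insert h′ g (lcpSum us) (length us)
    ... | tri> _ _ _ = uncompared-shift {h = h′} {g} {lcpSum us} (go h′ us)
    ... | tri≈ _ refl _
      with extend (drop h′ x) (drop h′ u) | extend-cost w (drop h′ x) (drop h′ u)
    ...   | k , true  , cs | cs-cost rewrite cost-++ w cs (place ∷ []) | cs-cost =
      compared-insert h′ k (lcpSum us) (length us)
    ...   | k , false , cs | cs-cost rewrite cost-++ w cs (shift ∷ proj₂ (scan x (h′ + k) us)) | cs-cost =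
      compared-shift {h = h′} {k} {h′} {lcpSum us} (go (h′ + k) us)

  scan-↭ : ∀ x h′ slots → map proj₂ (proj₁ (scan x h′ slots)) ↭ x ∷ map proj₂ slots
  scan-↭ x h′ [] = ↭-refl
  scan-↭ x h′ ((g , u) ∷ us) with <-cmp g h′
  ... | tri< _ _ _ = ↭-refl
  ... | tri> _ _ _ = ↭-trans (↭.prep u (scan-↭ x h′ us)) (↭.swap u x ↭-refl)
  ... | tri≈ _ _ _ with extend (drop h′ x) (drop h′ u)
  ...   | k , true  , cs = ↭-refl
  ...   | k , false , cs = ↭-trans (↭.prep u (scan-↭ x (h′ + k) us)) (↭.swap u x ↭-refl)

  insertAll-↭ : ∀ h̄ slots xs → map proj₂ (proj₁ (insertAll h̄ slots xs)) ↭ xs ++ map proj₂ slots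
  insertAll-↭ h̄ slots []       = ↭-refl
  insertAll-↭ h̄ slots (x ∷ xs) =
    ↭-trans (insertAll-↭ h̄ (proj₁ (scan x h̄ slots)) xs)
   (↭-trans (++⁺ˡ xs (scan-↭ x h̄ slots)) (↭-shift x xs (map proj₂ slots)))

  length-scan : ∀ x h′ slots → length (proj₁ (scan x h′ slots)) ≡ suc (length slots)
  length-scan x h′ slots = begin
    length (proj₁ (scan x h′ slots))              ≡⟨ length-map proj₂ (proj₁ (scan x h′ slots)) ⟨
    length (map proj₂ (proj₁ (scan x h′ slots)))  ≡⟨ ↭-length (scan-↭ x h′ slots) ⟩
    suc (length (map proj₂ slots))                ≡⟨ cong suc (length-map proj₂ slots) ⟩
    suc (length slots)                            ∎
    where open ≡-Reasoning

  -- The bounds of `scan-cost` telescope in `lcpSum`. Each insertion leaves a credit `h̄`, the value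
  -- its scan starts from; hence the term `length xs * h̄`.
  insertAll-cost : ∀ w h̄ slots xs →
                   cost w (proj₂ (insertAll h̄ slots xs)) + w charEqual * (length xs * h̄ + lcpSum slots) ≤
                   w charEqual * lcpSum (proj₁ (insertAll h̄ slots xs)) +
                     (stepCost w * rangeSum (length slots) (length xs) +
                      (length xs * (insertionCost w + w nextString) + w nextString))
  insertAll-cost w h̄ slots [] =
    ≤-slack 0 (lemma (w nextString) (w charEqual) (lcpSum slots) (stepCost w))
    where
    lemma : ∀ x e S A → (x + 0) + e * S + 0 ≡ e * S + (A * 0 + (0 + x))
    lemma = solve-∀
  insertAll-cost w h̄ slots (x ∷ xs) = begin
    next′ + cost w (ops₁ ++ ops₂) + e * (h̄ + n * h̄ + lcpSum slots)
      ≡⟨ cong (λ o → next′ + o + e * (h̄ + n * h̄ + lcpSum slots)) (cost-++ w ops₁ ops₂) ⟩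
    next′ + (cost w ops₁ + cost w ops₂) + e * (h̄ + n * h̄ + lcpSum slots)
      ≡⟨ before next′ (cost w ops₁) (cost w ops₂) e h̄ n (lcpSum slots) ⟩
    (cost w ops₁ + e * (h̄ + lcpSum slots)) + (next′ + (cost w ops₂ + e * (n * h̄)))
      ≤⟨ +-monoˡ-≤ _ (scan-cost w x h̄ slots) ⟩
    (e * lcpSum slots′ + (A * m + i)) + (next′ + (cost w ops₂ + e * (n * h̄)))
      ≡⟨ between e (lcpSum slots′) (A * m + i) next′ (cost w ops₂) n h̄ ⟩
    (cost w ops₂ + e * (n * h̄ + lcpSum slots′)) + (A * m + i + next′)
      ≤⟨ +-monoˡ-≤ _ (insertAll-cost w h̄ slots′ xs) ⟩
    (e * lcpSum slots″ + (A * rangeSum (length slots′) n + (n * (i + next′) + next′))) + (A * m + i + next′)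
      ≡⟨ cong (λ m′ → (e * lcpSum slots″ + (A * rangeSum m′ n + (n * (i + next′) + next′))) + (A * m + i + next′))
           (length-scan x h̄ slots) ⟩
    (e * lcpSum slots″ + (A * rangeSum (suc m) n + (n * (i + next′) + next′))) + (A * m + i + next′)
      ≡⟨ after (e * lcpSum slots″) A (rangeSum (suc m) n) n i next′ m ⟩
    e * lcpSum slots″ + (A * (m + rangeSum (suc m) n) + (suc n * (i + next′) + next′)) ∎
    where
    open ≤-Reasoning
    e = w charEqual ; A = stepCost w ; i = insertionCost w ; next′ = w nextString
    m = length slots ; n = length xs
    slots′ = proj₁ (scan x h̄ slots)
    ops₁ = proj₂ (scan x h̄ slots)
    slots″ = proj₁ (insertAll h̄ slots′ xs)
    ops₂ = proj₂ (insertAll h̄ slots′ xs)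
    before : ∀ x o p e h n S → x + (o + p) + e * (h + n * h + S) ≡ (o + e * (h + S)) + (x + (p + e * (n * h)))
    before = solve-∀
    between : ∀ e S r x p n h → (e * S + r) + (x + (p + e * (n * h))) ≡ (p + e * (n * h + S)) + (r + x)
    between = solve-∀
    after : ∀ E A R n i x m → (E + (A * R + (n * (i + x) + x))) + (A * m + i + x) ≡
                              E + (A * (m + R) + (suc n * (i + x) + x))
    after = solve-∀

  -- Longest common prefixes and the lexicographic order

  lcp-sym : ∀ s t → lcp s t ≡ lcp t s
  lcp-sym []      []      = refl
  lcp-sym []      (_ ∷ _) = refl
  lcp-sym (_ ∷ _) []      = refl
  lcp-sym (c ∷ s) (d ∷ t) with c ≟ d | d ≟ c
  ... | yes _   | yes _   = cong suc (lcp-sym s t)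
  ... | no  _   | no  _   = refl
  ... | yes c≈d | no  d≉c = contradiction (Eq.sym c≈d) d≉c
  ... | no  c≉d | yes d≈c = contradiction (Eq.sym d≈c) c≉d

  -- Transitivity of `_≈_`, position by position. The bound `h` stands for the minimum of the two
  -- LCPs and is what the recursion decreases.
  lcp-ultrametric : ∀ {h} s t u → h ≤ lcp s t → h ≤ lcp u t → h ≤ lcp s u
  lcp-ultrametric {zero}  s t u _ _ = z≤n
  lcp-ultrametric {suc h} (c ∷ s) (d ∷ t) (e ∷ u) p q with c ≟ d | e ≟ d | c ≟ e
  lcp-ultrametric {suc h} (c ∷ s) (d ∷ t) (e ∷ u) (s≤s p) (s≤s q) | yes _ | yes _ | yes _ =
    s≤s (lcp-ultrametric s t u p q)
  ... | yes c≈d | yes e≈d | no c≉e = contradiction (Eq.trans c≈d (Eq.sym e≈d)) c≉e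

  lcp-drop : ∀ {h} s t → h ≤ lcp s t → lcp s t ≡ h + lcp (drop h s) (drop h t)
  lcp-drop {zero}  s t _ = refl
  lcp-drop {suc h} (c ∷ s) (d ∷ t) p with c ≟ d
  lcp-drop {suc h} (c ∷ s) (d ∷ t) (s≤s p) | yes _ = cong suc (lcp-drop s t p)

  drop-cancel-≼ : ∀ {h} s t → h ≤ lcp s t → drop h s ≼ drop h t → s ≼ t
  drop-cancel-≼ {zero}  s t _ s≼t = s≼t
  drop-cancel-≼ {suc h} (c ∷ s) (d ∷ t) p s≼t with c ≟ d
  drop-cancel-≼ {suc h} (c ∷ s) (d ∷ t) (s≤s p) s≼t | yes c≈d = next c≈d (drop-cancel-≼ s t p s≼t)

  prefix-lcp : ∀ {p s t} → Prefix _≈_ p s → Prefix _≈_ p t → length p ≤ lcp s t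
  prefix-lcp []        _         = z≤n
  prefix-lcp {s = c ∷ _} {t = d ∷ _} (a≈c ∷ p) (a≈d ∷ q) with c ≟ d
  ... | yes _   = s≤s (prefix-lcp p q)
  ... | no  c≉d = contradiction (Eq.trans (Eq.sym a≈c) a≈d) c≉d

  -- Right after its LCP with `t`, the string `s` ends or has a smaller character than `t`. There
  -- `u` still agrees with `t`, so `s` parts from `u` at the same place and in the same direction.
  -- This settles both branches without character comparisons, with the inserted string in the role
  -- of `u` or of `s`.
  smaller-lcp⇒≼ : ∀ s t u → s ≼ t → u ≼ t → lcp s t < lcp u t → s ≼ u × lcp s u ≡ lcp s t
  smaller-lcp⇒≼ []      t       []      _ _ _ = base _ , refl
  smaller-lcp⇒≼ []      t       (_ ∷ _) _ _ _ = halt , refl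
  smaller-lcp⇒≼ (c ∷ s) (d ∷ t) (e ∷ u) s≼t u≼t lt with c ≟ d | e ≟ d | c ≟ e
  smaller-lcp⇒≼ (c ∷ s) (d ∷ t) (e ∷ u) s≼t u≼t (s≤s lt) | yes c≈d | yes e≈d | yes c≈e
    with s≼t | u≼t
  ... | next _ s≼t′ | next _ u≼t′ with smaller-lcp⇒≼ s t u s≼t′ u≼t′ lt
  ...   | s≼u , eq = next c≈e s≼u , cong suc eq
  smaller-lcp⇒≼ (c ∷ s) (d ∷ t) (e ∷ u) s≼t u≼t (s≤s lt) | yes c≈d | yes e≈d | yes c≈e
    | this c≺d | _ = contradiction c≺d (irrefl c≈d)
  smaller-lcp⇒≼ (c ∷ s) (d ∷ t) (e ∷ u) s≼t u≼t (s≤s lt) | yes c≈d | yes e≈d | yes c≈e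
    | _ | this e≺d = contradiction e≺d (irrefl e≈d)
  smaller-lcp⇒≼ (c ∷ s) (d ∷ t) (e ∷ u) s≼t u≼t lt | yes c≈d | yes e≈d | no c≉e =
    contradiction (Eq.trans c≈d (Eq.sym e≈d)) c≉e
  smaller-lcp⇒≼ (c ∷ s) (d ∷ t) (e ∷ u) s≼t u≼t lt | no c≉d | yes e≈d | yes c≈e =
    contradiction (Eq.trans c≈e e≈d) c≉d
  smaller-lcp⇒≼ (c ∷ s) (d ∷ t) (e ∷ u) (this c≺d) u≼t lt | no c≉d | yes e≈d | no c≉e =
    this (<-respʳ-≈ (Eq.sym e≈d) c≺d) , refl
  smaller-lcp⇒≼ (c ∷ s) (d ∷ t) (e ∷ u) (next c≈d _) u≼t lt | no c≉d | yes e≈d | no c≉e =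
    contradiction c≈d c≉d

  -- `extend` decides equality by `compare` and `lcp` by `_≟_`; the two tests cannot disagree.
  extend-lcp : ∀ x u → proj₁ (extend x u) ≡ lcp x u
  extend-lcp []      []      = refl
  extend-lcp []      (_ ∷ _) = refl
  extend-lcp (_ ∷ _) []      = refl
  extend-lcp (c ∷ x) (d ∷ u) with compare c d | c ≟ d
  ... | tri≈ _ _ _     | yes _   = cong suc (extend-lcp x u)
  ... | tri≈ _ c≈d _   | no  c≉d = contradiction c≈d c≉d
  ... | tri< _ c≉d _   | yes c≈d = contradiction c≈d c≉d
  ... | tri< _ _ _     | no  _   = refl
  ... | tri> _ c≉d _   | yes c≈d = contradiction c≈d c≉d
  ... | tri> _ _ _     | no  _   = refl

  extend-≼ : ∀ x u → if proj₁ (proj₂ (extend x u)) then u ≼ x else x ≼ u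
  extend-≼ []      []      = base _
  extend-≼ []      (_ ∷ _) = halt
  extend-≼ (_ ∷ _) []      = halt
  extend-≼ (c ∷ x) (d ∷ u) with compare c d
  ... | tri< c≺d _ _ = this c≺d
  ... | tri> _ _ d≺c = this d≺c
  ... | tri≈ _ c≈d _ with extend x u | extend-≼ x u
  ...   | _ , true  , _ | u≼x = next (Eq.sym c≈d) u≼x
  ...   | _ , false , _ | x≼u = next c≈d x≼u

  -- The invariant of the sorted prefix

  Fits : Set _
  Fits = ℕ → String → Set (a ⊔ ℓ₁ ⊔ ℓ₂)

  -- `Fit` constrains the first slot alone, the rightmost one. As a parameter it lets the rest of a
  -- scan, once past `u`, be treated as a scan at the boundary `LeftOf u`.
  data Valid (Fit : Fits) : Slots → Set (a ⊔ ℓ₁ ⊔ ℓ₂)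

  LeftOf : String → Fits
  LeftOf t g u = u ≼ t × g ≡ lcp u t

  data Valid Fit where
    []  : Valid Fit []
    _∷_ : ∀ {g u us} → Fit g u → Valid (LeftOf u) us → Valid Fit ((g , u) ∷ us)

  record Rightmost (p : String) (g : ℕ) (u : String) : Set (a ⊔ ℓ₁ ⊔ ℓ₂) where
    constructor rightmost
    field
      sentinel : g ≡ length p
      prefix   : Prefix _≈_ p u

  -- What a scan uses about the element to the right of the current position.  It holds both left
  -- of a string t and at the right end, where the sentinel takes the place of an LCP.
  record Boundary (Fit : Fits) : Set (a ⊔ ℓ₁ ⊔ ℓ₂) where
    field
      separates : ∀ {g h u x} → Fit g u → Fit h x → g < h → LeftOf x g u
      agrees    : ∀ {h u x} → Fit h u → Fit h x → h ≤ lcp x u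

  open Boundary

  leftOf-boundary : ∀ t → Boundary (LeftOf t)
  leftOf-boundary t .separates {u = u} {x} (u≼t , refl) (x≼t , refl) g<h
    with smaller-lcp⇒≼ u t x u≼t x≼t g<h
  ... | u≼x , eq = u≼x , sym eq
  leftOf-boundary t .agrees {u = u} {x} (_ , h≡ut) (_ , h≡xt) =
    lcp-ultrametric x t u (≤-reflexive h≡xt) (≤-reflexive h≡ut)

  -- Every fitting number equals `length p`, so at the right end only the branch that compares
  -- characters can occur, and there `p` itself is the known agreement.
  rightmost-boundary : ∀ p → Boundary (Rightmost p)
  rightmost-boundary p .separates (rightmost refl _) (rightmost refl _) g<h = contradiction g<h (<-irrefl refl)
  rightmost-boundary p .agrees (rightmost refl p⊑u) (rightmost _ p⊑x) = prefix-lcp p⊑x p⊑u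

  -- `Fit h′ x` is the loop invariant: `x` with entry `h′` could stand at the current boundary. Each
  -- branch either places `x` there or establishes the invariant anew for the boundary left of `u`.
  scan-valid : ∀ {Fit} → Boundary Fit → ∀ x h′ slots → Fit h′ x → Valid Fit slots →
               Valid Fit (proj₁ (scan x h′ slots))
  scan-valid B x h′ [] fit-x [] = fit-x ∷ []
  scan-valid B x h′ ((g , u) ∷ us) fit-x (fit-u ∷ valid) with <-cmp g h′
  ... | tri< g<h′ _ _ = fit-x ∷ (separates B fit-u fit-x g<h′ ∷ valid)
  -- `separates` with the roles of `x` and `u` exchanged gives `x ≼ u` and `h′ ≡ lcp x u`, so `h′`
  -- remains correct after the shift.
  ... | tri> _ _ h′<g = fit-u ∷ scan-valid (leftOf-boundary u) x h′ us (separates B fit-x fit-u h′<g) valid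
  ... | tri≈ _ refl _
    with extend (drop h′ x) (drop h′ u) | extend-lcp (drop h′ x) (drop h′ u) | extend-≼ (drop h′ x) (drop h′ u)
  -- `extend` resumes behind `h′` characters known to agree, so `h′ + k` is `lcp x u`; the slot of
  -- `u` must hold `lcp u x`, hence the symmetry.
  ...   | k , true  , _ | refl | u≼x =
    fit-x ∷ ((drop-cancel-≼ u x h′≤ux u≼x , trans (sym (lcp-drop x u h′≤xu)) (lcp-sym x u)) ∷ valid)
    where
    h′≤xu = agrees B fit-u fit-x
    h′≤ux = agrees B fit-x fit-u
  ...   | k , false , _ | refl | x≼u =
    fit-u ∷ scan-valid (leftOf-boundary u) x (h′ + k) us
              (drop-cancel-≼ x u h′≤xu x≼u , sym (lcp-drop x u h′≤xu)) valid
    where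
    h′≤xu = agrees B fit-u fit-x

  insertAll-valid : ∀ p slots {xs} → All (Prefix _≈_ p) xs → Valid (Rightmost p) slots →
                    Valid (Rightmost p) (proj₁ (insertAll (length p) slots xs))
  insertAll-valid p slots []                       valid = valid
  insertAll-valid p slots {x ∷ _} (p⊑x ∷ p⊑xs) valid =
    insertAll-valid p _ p⊑xs
      (scan-valid (rightmost-boundary p) x (length p) slots (rightmost refl p⊑x) valid)

  -- `reverse` is an accumulator loop: `t ∷ ts` is the part already turned around, and its head is
  -- the right neighbour of the next slot.
  valid⇒sorted : ∀ {t ts slots} → Valid (LeftOf t) slots → Sorted (t ∷ ts) →
                 Sorted (reverseAcc (t ∷ ts) (map proj₂ slots))
  valid⇒sorted []                    sorted = sorted
  valid⇒sorted ((u≼t , _) ∷ valid) sorted = valid⇒sorted valid (u≼t ∷ sorted)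

  valid⇒lcpArray : ∀ {t ts slots} → Valid (LeftOf t) slots →
                   lcpArray (reverseAcc (t ∷ ts) (map proj₂ slots)) ≡
                   nothing ∷ reverseAcc (map just (zipWith lcp (t ∷ ts) ts)) (map (λ slot → just (proj₁ slot)) slots)
  valid⇒lcpArray []                      = refl
  valid⇒lcpArray ((_ , refl) ∷ valid) = valid⇒lcpArray valid

  slotStrings-sorted : ∀ {Fit slots} → Valid Fit slots → Sorted (slotStrings slots)
  slotStrings-sorted []          = []
  slotStrings-sorted (_ ∷ valid) = valid⇒sorted valid [-]

  slotLCPs-correct : ∀ {Fit slots} → Valid Fit slots → slotLCPs slots ≡ lcpArray (slotStrings slots)
  slotLCPs-correct []          = refl
  slotLCPs-correct (_ ∷ valid) = sym (valid⇒lcpArray valid)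

  -- The extra `length p` is the sentinel in the rightmost slot. It is absent when there are no
  -- slots, hence an inequality.
  lcpSum-slotLCPs : ∀ {p slots} → Valid (Rightmost p) slots → lcpSum slots ≤ length p + L (slotLCPs slots)
  lcpSum-slotLCPs []                                        = z≤n
  lcpSum-slotLCPs {slots = _ ∷ slots} (rightmost refl _ ∷ _) =
    +-monoʳ-≤ _ (≤-reflexive (trans (sym (+-identityʳ _)) (trans (sym (L-reverseAcc [] (map proj₁ slots)))
      (cong (λ gs → L (reverseAcc [] gs)) (sym (map-∘ slots))))))

  -- The distinguishing prefix size

  -- A prefix within the LCP never reaches the terminator, so it consists of characters that `t`
  -- repeats. Ranging over `inits` fits the search for the first unshared prefix.
  shared-inits : ∀ s t → All (λ p → length p ≤ lcp s t → Prefix _≈₋_ p (terminated t))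
                             (inits (terminated s))
  shared-inits []      t       = (λ _ → []) ∷ (λ ()) ∷ []
  shared-inits (c ∷ s) []      = (λ _ → []) ∷ gmap⁺ (λ _ ()) (shared-inits s [])
  shared-inits (c ∷ s) (d ∷ t) with c ≟ d
  ... | yes c≈d = (λ _ → []) ∷ gmap⁺ (λ { shared (s≤s le) → [ c≈d ]₋ ∷ shared le }) (shared-inits s t)
  ... | no  _   = (λ _ → []) ∷ gmap⁺ (λ _ ()) (shared-inits s t)

  lcp≤length : ∀ s t → lcp s t ≤ length (terminated s)
  lcp≤length []      t       = z≤n
  lcp≤length (c ∷ s) []      = z≤n
  lcp≤length (c ∷ s) (d ∷ t) with c ≟ d
  ... | yes _ = s≤s (lcp≤length s t)
  ... | no  _ = z≤n

  -- An unshared prefix must be longer than the LCP, since otherwise `t` would share it. If the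
  -- search finds none, the default is the whole terminated string, which is at least as long as the
  -- LCP.
  lcp≤distinguishingLength : ∀ s {t others} → t ∈ others → lcp s t ≤ distinguishingLength s others
  lcp≤distinguishingLength s {t} {others} t∈others =
    find-length-≥ (λ p → ¬? (sharedBy? others p)) (lcp s t) (terminated s)
      (All.map (λ {p} shared unshared →
                  <⇒≤ (≰⇒> (λ p≤lcp → unshared (lose t∈others (shared p≤lcp)))))
               (shared-inits s t))
      (lcp≤length s t)

  distinguishingLength-↭ : ∀ s {ts us} → ts ↭ us → distinguishingLength s ts ≡ distinguishingLength s us
  distinguishingLength-↭ s {ts} {us} ts↭us =
    cong (λ found → length (maybe′ (λ p → p) (terminated s) found))
      (find-cong (λ p → ¬? (sharedBy? ts p)) (λ p → ¬? (sharedBy? us p))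
        (λ _ ¬ts → ¬ts ∘ Any-resp-↭ (↭-sym ts↭us)) (λ _ ¬us → ¬us ∘ Any-resp-↭ ts↭us)
        (inits (terminated s)))

  -- Carries the bound on `L`, obtained for the sorted strings, back to the input order.
  D-↭ : ∀ {ss ts} → ss ↭ ts → D ss ≡ D ts
  D-↭ = sumPicks-↭ distinguishingLength distinguishingLength-↭

  -- The LCP of two neighbours is charged to the left one, whose other strings still include its
  -- right neighbour once the strings before it have been split off into f.
  L≤sumPicks : ∀ f → (∀ s {t others} → t ∈ others → lcp s t ≤ f s others) →
               ∀ ss → L (lcpArray ss) ≤ sumPicks f ss
  L≤sumPicks f lcp≤f []           = z≤n
  L≤sumPicks f lcp≤f (s ∷ [])     = z≤n
  L≤sumPicks f lcp≤f (s ∷ t ∷ ss) =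
    +-mono-≤ (lcp≤f s (here refl))
             (L≤sumPicks (λ u others → f u (s ∷ others)) (λ u → lcp≤f u ∘ there) (t ∷ ss))

  L≤D : ∀ ss → L (lcpArray ss) ≤ D ss
  L≤D = L≤sumPicks distinguishingLength lcp≤distinguishingLength

  -- The cost of the whole sort.

  sort-cost : ∀ w p {ss} → All (Prefix _≈_ p) ss →
              let open Run (lcpInsertionSort (length p) ss) in
              cost w trace ≤ w charEqual * L lcps +
                             (stepCost w * rangeSum 0 (length ss) +
                              (length ss * (insertionCost w + w nextString) + w nextString))
  sort-cost w p {[]}          _    = ≤-slack 0 (lemma (w nextString) (w charEqual) (stepCost w))
    where
    lemma : ∀ x e A → x + 0 + 0 ≡ e * 0 + (A * 0 + (0 + x))
    lemma = solve-∀
  -- The credit `h̄` of one insertion cancels the sentinel contained in `lcpSum`; the credits of the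
  -- other insertions are dropped.
  sort-cost w p {ss@(_ ∷ xs)} p⊑ss = +-cancelˡ-≤ (e * h̄) _ _ (begin
    e * h̄ + cost w trace
      ≤⟨ m≤m+n _ (e * (length xs * h̄)) ⟩
    e * h̄ + cost w trace + e * (length xs * h̄)
      ≡⟨ before e h̄ (cost w trace) (length xs) ⟩
    cost w trace + e * (length ss * h̄ + 0)
      ≤⟨ insertAll-cost w h̄ [] ss ⟩
    e * lcpSum (proj₁ (insertAll h̄ [] ss)) + rest
      ≤⟨ +-monoˡ-≤ rest (*-monoʳ-≤ e (lcpSum-slotLCPs (insertAll-valid p [] p⊑ss []))) ⟩
    e * (h̄ + L lcps) + rest
      ≡⟨ after e h̄ (L lcps) rest ⟩
    e * h̄ + (e * L lcps + rest) ∎)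
    where
    open ≤-Reasoning
    open Run (lcpInsertionSort (length p) ss)
    h̄ = length p
    e = w charEqual
    rest = stepCost w * rangeSum 0 (length ss) +
           (length ss * (insertionCost w + w nextString) + w nextString)
    before : ∀ e h o m → e * h + o + e * (m * h) ≡ o + e * (suc m * h + 0)
    before = solve-∀
    after : ∀ e h l r → e * (h + l) + r ≡ e * h + (e * l + r)
    after = solve-∀

  -- Correctness and the two bounds for a given input.

  module _ (p : String) {ss : List String} (common : All (Prefix _≈_ p) ss) where
    open Run (lcpInsertionSort (length p) ss)

    strings-↭ : strings ↭ ss
    strings-↭ = ↭-trans (↭-reverse _) (↭-trans (insertAll-↭ (length p) [] ss) (↭-reflexive (++-identityʳ ss)))

    strings-sorted : Sorted strings
    strings-sorted = slotStrings-sorted (insertAll-valid p [] common [])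

    lcps-correct : lcps ≡ lcpArray strings
    lcps-correct = slotLCPs-correct (insertAll-valid p [] common [])

    charComparisons-bound : charComparisons trace ≤ L lcps + length ss * (length ss ∸ 1) / 2
    charComparisons-bound = begin
      charComparisons trace                             ≤⟨ sort-cost charWeight p common ⟩
      -- Under `charWeight` an equal comparison and a step both weigh 1, an insertion and a loop
      -- test 0.
      1 * L lcps + (1 * rangeSum 0 n + (n * 0 + 0))     ≡⟨ simplify (L lcps) (rangeSum 0 n) n ⟩
      L lcps + rangeSum 0 n                             ≡⟨ cong (L lcps +_) (rangeSum-0 n) ⟩
      L lcps + n * (n ∸ 1) / 2                          ∎
      where
      open ≤-Reasoning
      n = length ss
      simplify : ∀ l r n → 1 * l + (1 * r + (n * 0 + 0)) ≡ l + r
      simplify = solve-∀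

    L≤D-input : L lcps ≤ D ss
    L≤D-input = begin
      L lcps                ≡⟨ cong L lcps-correct ⟩
      L (lcpArray strings)  ≤⟨ L≤D strings ⟩
      D strings             ≡⟨ D-↭ strings-↭ ⟩
      D ss                  ∎
      where open ≤-Reasoning

    cost-bound : ∀ w → 1 ≤ length ss →
                 cost w trace ≤ timeConstant w * (D ss + length ss ^ 2)
    cost-bound w 1≤n = begin
      cost w trace                                              ≤⟨ sort-cost w p common ⟩
      e * L lcps + (A * rangeSum 0 n + (n * (i + x) + x))
        ≤⟨ +-mono-≤ (*-monoʳ-≤ e (≤-trans L≤D-input (m≤m+n _ _)))
             (+-mono-≤ (*-monoʳ-≤ A (≤-trans (rangeSum-≤-square n) n*n≤N))
               (+-mono-≤ (≤-trans (≤-reflexive (*-comm n (i + x))) (*-monoʳ-≤ (i + x) (≤-trans n≤n*n n*n≤N)))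
                 -- `1 ≤ n` makes `N` positive, which absorbs the last loop test; for the empty
                 -- input `N` is 0 although that test still takes place.
                 (≤-trans (≤-reflexive (sym (*-identityʳ x))) (*-monoʳ-≤ x (≤-trans 1≤n (≤-trans n≤n*n n*n≤N)))))) ⟩
      e * N + (A * N + ((i + x) * N + x * N))                   ≡⟨ factor e A (i + x) x N ⟩
      (e + (A + (i + x + x))) * N                               ∎
      where
      open ≤-Reasoning
      n = length ss ; N = D ss + n ^ 2
      e = w charEqual ; A = stepCost w ; i = insertionCost w ; x = w nextString
      n≤n*n : n ≤ n * n
      n≤n*n = ≤-trans (≤-reflexive (sym (*-identityʳ n))) (*-monoʳ-≤ n 1≤n)
      n*n≤N : n * n ≤ N
      -- `n ^ 2` unfolds to `n * (n * 1)`.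
      n*n≤N = ≤-trans (≤-reflexive (cong (n *_) (sym (*-identityʳ n)))) (m≤n+m _ (D ss))
      factor : ∀ e A j x N → e * N + (A * N + (j * N + x * N)) ≡ (e + (A + (j + x))) * N
      factor = solve-∀

mainTheorem6 : ∀ {a ℓ₁ ℓ₂} →
    ((Alphabet : StrictTotalOrder a ℓ₁ ℓ₂) → let open Strings Alphabet in
     (h̄ : ℕ) (ss : List String) → HasCommonPrefixLength h̄ ss →
     let n = length ss
         open Run (lcpInsertionSort h̄ ss)
     in strings ↭ ss
        × Sorted strings
        × lcps ≡ lcpArray strings
        × charComparisons trace ≤ L lcps + n * (n ∸ 1) / 2)
    ×
    ((w : Op → ℕ) → ∃[ C ]
     ((Alphabet : StrictTotalOrder a ℓ₁ ℓ₂) → let open Strings Alphabet in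
      (h̄ : ℕ) (ss : List String) → HasCommonPrefixLength h̄ ss →
      let n = length ss
          open Run (lcpInsertionSort h̄ ss)
      in 1 ≤ n → cost w trace ≤ C * (D ss + n ^ 2)))
mainTheorem6 =
  (λ { Alphabet _ ss (p , refl , common) → let open Correctness Alphabet in
       strings-↭ p common , strings-sorted p common , lcps-correct p common , charComparisons-bound p common }) ,
  (λ w → timeConstant w , λ { Alphabet _ ss (p , refl , common) → Correctness.cost-bound Alphabet p common w })
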